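{- Let $m\geq 3$ and let $h_1\geq h_2\geq h_3$ and $h_4$ be positive integers. Let $k=m+3$, $n=h_1+h_2+h_3+mh_4$, and $\sum_{i=1}^k h_i^2 = h_1^2+h_2^2+h_3^2+mh_4^2$. Then an $\mathrm{ROS}(h_1h_2h_3h_4^m)$ exists if and only if all of the following hold: (1) $n^2-\sum_{i=1}^k h_i^2\geq 3mh_4(h_1+h_2+h_3)$; (2) $n^2-\sum_{i=1}^k h_i^2\geq 3(mh_4+h_j)(n-mh_4-h_j)$ for every $j\in\{1,2,3\}$; (3) $h_1(h_2+h_3)\leq mh_1h_4+2h_2h_3$; (4) $h_4\geq \frac{1}{m}(h_1-h_3)$.
   Context: Given a sequence $P=(p_1,\dots,p_k)$ of positive integers, an $\mathrm{ROS}(P)$ (symmetric rational outline square respecting $P$) is an assignment of a non-negative rational number $O(i,j,\ell)$ to every multiset $\{i,j,\ell\}$ of elements of $[k]=\{1,\dots,k\}$ (so the value is invariant under permuting $i,j,\ell$) such that $\sum_{\ell\in[k]}O(i,j,\ell)=p_ip_j$ for all $i,j\in[k]$, and $O(i,i,i)=p_i^2$ and $O(i,i,j)=0$ for all $i\neq j$. The notation $h^m$ means $m$ parts equal to $h$; no order between $h_4$ and $h_1,h_2,h_3$ is assumed. -}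

module Defs where

open import Data.Nat using (ℕ; zero; suc; _*_; _^_)
open import Data.Fin using (Fin; zero; suc)
open import Data.Integer using (+_)
open import Data.Rational using (ℚ; 0ℚ; _+_; _≤_; _/_)
open import Data.Vec using (Vec; _∷_; replicate; lookup)
open import Relation.Binary.PropositionalEquality using (_≡_; _≢_)

ℕtoℚ : ℕ → ℚ
ℕtoℚ n = + n / 1

sumℚ : ∀ {k} → (Fin k → ℚ) → ℚ
sumℚ {zero} f = 0ℚ
sumℚ {suc k} f = f zero + sumℚ (λ i → f (suc i))

-- O is a function on triples, required invariant under all permutations
-- (generated by the two transpositions), hence a function on multisets.
record ROS {k : ℕ} (p : Fin k → ℕ) : Set where
  field
    O        : Fin k → Fin k → Fin k → ℚ
    symm₁₂   : ∀ i j l → O i j l ≡ O j i l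
    symm₂₃   : ∀ i j l → O i j l ≡ O i l j
    nonneg   : ∀ i j l → 0ℚ ≤ O i j l
    lineSum  : ∀ i j → sumℚ (λ l → O i j l) ≡ ℕtoℚ (p i * p j)
    diagonal : ∀ i → O i i i ≡ ℕtoℚ (p i ^ 2)
    offDiag  : ∀ i j → i ≢ j → O i i j ≡ 0ℚ

seqP : (m h₁ h₂ h₃ h₄ : ℕ) → Fin (3 Data.Nat.+ m) → ℕ
seqP m h₁ h₂ h₃ h₄ = lookup (h₁ ∷ h₂ ∷ h₃ ∷ replicate m h₄)

-- Write T = O(1,2,3) and call the indices carrying h₄ ordinary. Summing the line equations
-- Σₗ O(i,j,l) = pᵢ pⱼ over the ordinary indices expresses the mass of every block of an ROS
-- through T: for special a, b, c the blocks O(a,b,·), O(a,·,·) and O(·,·,·) (dots ordinary)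
-- carry hₐh_b − T, 2T − ℓₐ with ℓₐ = hₐ(h_b + h_c − m h₄), and D − 3m h₄(h₁+h₂+h₃) − 6T,
-- where D = n² − Σ hᵢ². So an ROS forces a value of T making all these masses nonnegative, and
-- eliminating T from that linear system (Fourier–Motzkin) leaves exactly conditions (1)–(4).
-- Conversely, for such a T, spreading each block's mass evenly over its ordinary indices
-- gives an ROS; this divides by m, m − 1 and m − 2, hence m ≥ 3.

module Submission where

open import Agda.Builtin.FromNat using (Number; fromNat)
open import Data.Bool using (Bool; true; false; if_then_else_; _∨_)
open import Data.Bool.Properties using (∨-assoc; ∨-comm)
open import Data.Empty using (⊥-elim)
open import Data.Fin using (Fin; zero; suc)
import Data.Fin.Properties as Finₚ
open import Data.Integer as ℤ using (ℤ; +0; +[1+_]; -[1+_])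
import Data.Integer.Properties as ℤₚ
open import Data.List using (_∷_; [])
open import Data.Maybe using (Maybe; just; nothing)
open import Data.Nat using (ℕ; suc)
import Data.Nat as ℕ
import Data.Nat.Literals as ℕ-literals
import Data.Nat.Properties as ℕₚ
open import Data.Product using (_×_; _,_; proj₁; proj₂)
open import Data.Rational.Literals using (fromℤ; number)
import Data.Rational.Properties as ℚₚ
open import Data.Sum using ([_,_]′)
open import Data.Unit using (⊤; tt)
open import Data.Vec.Properties using (lookup-replicate)
open import Defs
open import Function.Base using (_∘_)
open import Function.Bundles using (_⇔_; mk⇔; module Equivalence)
open import Relation.Binary.PropositionalEquality
open import Relation.Nullary using (Dec; yes; no; does)
open import Relation.Nullary.Decidable using (dec-true; dec-false)
open import Tactic.RingSolver using (solve)
open import Tactic.RingSolver.Core.AlmostCommutativeRing using (AlmostCommutativeRing; fromCommutativeRing)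

-- ℚ's operators are opened only inside this module: the statement at the end uses ℤ's.
module _ where
  open import Data.Rational
    using (ℚ; 0ℚ; 1ℚ; ½; _/_; 1/_; _÷_; _⊔_; _+_; _*_; _-_; -_; _≤_; _<_; *≤*; NonZero; nonNegative; positive)

  -- With fromNat in scope every numeric literal is overloaded, so ℕ needs an instance too.
  instance
    ⊤-instance : ⊤
    ⊤-instance = tt
    ℕ-number : Number ℕ
    ℕ-number = ℕ-literals.number
    ℚ-number : Number ℚ
    ℚ-number = number

  ℚ-ring : AlmostCommutativeRing _ _
  ℚ-ring = fromCommutativeRing ℚₚ.+-*-commutativeRing isZero
    where
    isZero : ∀ p → Maybe (0ℚ ≡ p)
    isZero p with 0ℚ ℚₚ.≟ p
    ... | yes 0≡p = just 0≡p
    ... | no _    = nothing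

  fromℤ-/1 : ∀ z → z / 1 ≡ fromℤ z
  fromℤ-/1 z = ℚₚ.↥p/↧p≡p (fromℤ z)

  fromℕ : ℕ → ℚ
  fromℕ n = fromℤ (ℤ.+ n)

  ℕtoℚ≡fromℕ : ∀ n → ℕtoℚ n ≡ fromℕ n
  ℕtoℚ≡fromℕ n = fromℤ-/1 (ℤ.+ n)

  fromℤ-homo-+ : ∀ a b → fromℤ (a ℤ.+ b) ≡ fromℤ a + fromℤ b
  fromℤ-homo-+ a b = sym (trans (cong₂ (λ x y → (x ℤ.+ y) / 1) (ℤₚ.*-identityʳ a) (ℤₚ.*-identityʳ b)) (fromℤ-/1 (a ℤ.+ b)))

  fromℤ-homo-* : ∀ a b → fromℤ (a ℤ.* b) ≡ fromℤ a * fromℤ b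
  fromℤ-homo-* a b = sym (fromℤ-/1 (a ℤ.* b))

  fromℤ-homo‿- : ∀ a → fromℤ (ℤ.- a) ≡ - fromℤ a
  fromℤ-homo‿- +0       = refl
  fromℤ-homo‿- +[1+ n ] = refl
  fromℤ-homo‿- -[1+ n ] = refl

  fromℤ-homo-minus : ∀ a b → fromℤ (a ℤ.- b) ≡ fromℤ a - fromℤ b
  fromℤ-homo-minus a b = trans (fromℤ-homo-+ a (ℤ.- b)) (cong₂ _+_ refl (fromℤ-homo‿- b))

  fromℤ-mono-≤ : ∀ {a b} → a ℤ.≤ b → fromℤ a ≤ fromℤ b
  fromℤ-mono-≤ {a} {b} a≤b = *≤* (subst₂ ℤ._≤_ (sym (ℤₚ.*-identityʳ a)) (sym (ℤₚ.*-identityʳ b)) a≤b)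

  fromℤ-cancel-≤ : ∀ {a b} → fromℤ a ≤ fromℤ b → a ℤ.≤ b
  fromℤ-cancel-≤ {a} {b} (*≤* a≤b) = subst₂ ℤ._≤_ (ℤₚ.*-identityʳ a) (ℤₚ.*-identityʳ b) a≤b

  ℕtoℚ-* : ∀ a b → ℕtoℚ (a ℕ.* b) ≡ fromℕ a * fromℕ b
  ℕtoℚ-* a b = trans (ℕtoℚ≡fromℕ (a ℕ.* b)) (trans (cong fromℤ (ℤₚ.pos-* a b)) (fromℤ-homo-* (ℤ.+ a) (ℤ.+ b)))

  ℕtoℚ-^2 : ∀ a → ℕtoℚ (a ℕ.^ 2) ≡ fromℕ a * fromℕ a
  ℕtoℚ-^2 a = trans (cong (λ b → ℕtoℚ (a ℕ.* b)) (ℕₚ.*-identityʳ a)) (ℕtoℚ-* a a)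

  -- The conditions are written once as syntax so that their meanings in ℤ (the statement)
  -- and in ℚ (where T lives) are related by fromℤ-⟦⟧.

  infixl 6 _⊕_ _⊖_
  infixl 7 _⊗_

  data Expr (A : Set) : Set where
    ⟨_⟩ : A → Expr A
    lit : ℕ → Expr A
    _⊕_ _⊗_ _⊖_ : Expr A → Expr A → Expr A

  mapExpr : ∀ {A B : Set} → (A → B) → Expr A → Expr B
  mapExpr f ⟨ a ⟩    = ⟨ f a ⟩
  mapExpr f (lit n) = lit n
  mapExpr f (e ⊕ e′) = mapExpr f e ⊕ mapExpr f e′
  mapExpr f (e ⊗ e′) = mapExpr f e ⊗ mapExpr f e′
  mapExpr f (e ⊖ e′) = mapExpr f e ⊖ mapExpr f e′

  ⟦_⟧ℤ : Expr ℤ → ℤ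
  ⟦ ⟨ a ⟩ ⟧ℤ    = a
  ⟦ lit n ⟧ℤ   = ℤ.+ n
  ⟦ e ⊕ e′ ⟧ℤ = ⟦ e ⟧ℤ ℤ.+ ⟦ e′ ⟧ℤ
  ⟦ e ⊗ e′ ⟧ℤ = ⟦ e ⟧ℤ ℤ.* ⟦ e′ ⟧ℤ
  ⟦ e ⊖ e′ ⟧ℤ = ⟦ e ⟧ℤ ℤ.- ⟦ e′ ⟧ℤ

  ⟦_⟧ℚ : Expr ℚ → ℚ
  ⟦ ⟨ a ⟩ ⟧ℚ    = a
  ⟦ lit n ⟧ℚ   = fromℕ n
  ⟦ e ⊕ e′ ⟧ℚ = ⟦ e ⟧ℚ + ⟦ e′ ⟧ℚ
  ⟦ e ⊗ e′ ⟧ℚ = ⟦ e ⟧ℚ * ⟦ e′ ⟧ℚ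
  ⟦ e ⊖ e′ ⟧ℚ = ⟦ e ⟧ℚ - ⟦ e′ ⟧ℚ

  fromℤ-⟦⟧ : ∀ e → fromℤ ⟦ e ⟧ℤ ≡ ⟦ mapExpr fromℤ e ⟧ℚ
  fromℤ-⟦⟧ ⟨ a ⟩    = refl
  fromℤ-⟦⟧ (lit n) = refl
  fromℤ-⟦⟧ (e ⊕ e′) = trans (fromℤ-homo-+ ⟦ e ⟧ℤ ⟦ e′ ⟧ℤ) (cong₂ _+_ (fromℤ-⟦⟧ e) (fromℤ-⟦⟧ e′))
  fromℤ-⟦⟧ (e ⊗ e′) = trans (fromℤ-homo-* ⟦ e ⟧ℤ ⟦ e′ ⟧ℤ) (cong₂ _*_ (fromℤ-⟦⟧ e) (fromℤ-⟦⟧ e′))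
  fromℤ-⟦⟧ (e ⊖ e′) = trans (fromℤ-homo-minus ⟦ e ⟧ℤ ⟦ e′ ⟧ℤ) (cong₂ _-_ (fromℤ-⟦⟧ e) (fromℤ-⟦⟧ e′))

  _≤ℤ-expr_ : Expr ℤ → Expr ℤ → Set
  e ≤ℤ-expr e′ = ⟦ e ⟧ℤ ℤ.≤ ⟦ e′ ⟧ℤ

  _≤ℚ-expr_ : Expr ℚ → Expr ℚ → Set
  e ≤ℚ-expr e′ = ⟦ e ⟧ℚ ≤ ⟦ e′ ⟧ℚ

  fromℤ-≤-expr : ∀ {e e′} → e ≤ℤ-expr e′ → mapExpr fromℤ e ≤ℚ-expr mapExpr fromℤ e′
  fromℤ-≤-expr {e} {e′} e≤e′ = subst₂ _≤_ (fromℤ-⟦⟧ e) (fromℤ-⟦⟧ e′) (fromℤ-mono-≤ e≤e′)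

  fromℤ-≤-expr⁻ : ∀ {e e′} → mapExpr fromℤ e ≤ℚ-expr mapExpr fromℤ e′ → e ≤ℤ-expr e′
  fromℤ-≤-expr⁻ {e} {e′} e≤e′ = fromℤ-cancel-≤ (subst₂ _≤_ (sym (fromℤ-⟦⟧ e)) (sym (fromℤ-⟦⟧ e′)) e≤e′)

  -- With leaves + m, + h₁, … and _≤ℤ-expr_, Conditions is definitionally the right-hand side
  -- of mainTheorem6.

  module Conditions {A : Set} (m h₁ h₂ h₃ h₄ : A) where
    M H₁ H₂ H₃ H₄ N S D : Expr A
    M  = ⟨ m ⟩
    H₁ = ⟨ h₁ ⟩
    H₂ = ⟨ h₂ ⟩
    H₃ = ⟨ h₃ ⟩
    H₄ = ⟨ h₄ ⟩
    N  = H₁ ⊕ H₂ ⊕ H₃ ⊕ M ⊗ H₄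
    S  = H₁ ⊗ H₁ ⊕ H₂ ⊗ H₂ ⊕ H₃ ⊗ H₃ ⊕ M ⊗ (H₄ ⊗ H₄)
    D  = N ⊗ N ⊖ S

    lhs₁ : Expr A
    lhs₁ = lit 3 ⊗ M ⊗ H₄ ⊗ (H₁ ⊕ H₂ ⊕ H₃)

    lhs₂ : Expr A → Expr A
    lhs₂ Hⱼ = lit 3 ⊗ (M ⊗ H₄ ⊕ Hⱼ) ⊗ (N ⊖ M ⊗ H₄ ⊖ Hⱼ)

    Conditions : (Expr A → Expr A → Set) → Set
    Conditions _≼_ =
        lhs₁ ≼ D
      × (lhs₂ H₁ ≼ D × lhs₂ H₂ ≼ D × lhs₂ H₃ ≼ D)
      × (H₁ ⊗ (H₂ ⊕ H₃)) ≼ (M ⊗ H₁ ⊗ H₄ ⊕ lit 2 ⊗ H₂ ⊗ H₃)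
      × (H₁ ⊖ H₃) ≼ (M ⊗ H₄)

  open Conditions using (Conditions)

  Conditions-mono : ∀ {A : Set} (m h₁ h₂ h₃ h₄ : A) {R R′ : Expr A → Expr A → Set} →
    (∀ {e e′} → R e e′ → R′ e e′) → Conditions m h₁ h₂ h₃ h₄ R → Conditions m h₁ h₂ h₃ h₄ R′
  Conditions-mono _ _ _ _ _ f (c₁ , (c₂ , c₂′ , c₂″) , c₃ , c₄) = f c₁ , (f c₂ , f c₂′ , f c₂″) , f c₃ , f c₄

  Conditions-fromℤ : ∀ m h₁ h₂ h₃ h₄ → Conditions m h₁ h₂ h₃ h₄ _≤ℤ-expr_ ⇔
                     Conditions (fromℤ m) (fromℤ h₁) (fromℤ h₂) (fromℤ h₃) (fromℤ h₄) _≤ℚ-expr_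
  Conditions-fromℤ m h₁ h₂ h₃ h₄ = mk⇔
    (Conditions-mono m h₁ h₂ h₃ h₄ (λ {e} {e′} → fromℤ-≤-expr {e} {e′}))
    (Conditions-mono m h₁ h₂ h₃ h₄ (λ {e} {e′} → fromℤ-≤-expr⁻ {e} {e′}))

  x≤x+y : ∀ {x y} → 0ℚ ≤ y → x ≤ x + y
  x≤x+y {x} 0≤y = subst (_≤ x + _) (ℚₚ.+-identityʳ x) (ℚₚ.+-monoʳ-≤ x 0≤y)

  x-y≤x : ∀ {x y} → 0ℚ ≤ y → x - y ≤ x
  x-y≤x {x} 0≤y = subst (x - _ ≤_) (ℚₚ.+-identityʳ x) (ℚₚ.+-monoʳ-≤ x (ℚₚ.neg-antimono-≤ 0≤y))

  0≤y-x : ∀ {x y} → x ≤ y → 0ℚ ≤ y - x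
  0≤y-x {x} {y} x≤y = subst (_≤ y - x) (ℚₚ.+-inverseʳ x) (ℚₚ.+-monoˡ-≤ (- x) x≤y)

  0≤* : ∀ {x y} → 0ℚ ≤ x → 0ℚ ≤ y → 0ℚ ≤ x * y
  0≤* {x} {y} 0≤x 0≤y = subst (_≤ x * y) (ℚₚ.*-zeroʳ x) (ℚₚ.*-monoˡ-≤-nonNeg x {{nonNegative 0≤x}} 0≤y)

  0≤y-x⇒x≤y : ∀ {x y} → 0ℚ ≤ y - x → x ≤ y
  0≤y-x⇒x≤y {x} {y} 0≤y-x = subst₂ _≤_ (ℚₚ.+-identityˡ x) (y-x+x y x) (ℚₚ.+-monoˡ-≤ x 0≤y-x)
    where
    y-x+x : ∀ y x → y - x + x ≡ y
    y-x+x y x = solve (y ∷ x ∷ []) ℚ-ring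

  cong₃ : ∀ {A B C D : Set} (f : A → B → C → D) {a a′ b b′ c c′} → a ≡ a′ → b ≡ b′ → c ≡ c′ → f a b c ≡ f a′ b′ c′
  cong₃ f refl refl refl = refl

  0≤fromℕ : ∀ n → 0ℚ ≤ fromℕ n
  0≤fromℕ n = fromℤ-mono-≤ (ℤ.+≤+ ℕ.z≤n)

  ÷-cancelˡ : ∀ p .{{_ : NonZero p}} q → p * (q ÷ p) ≡ q
  ÷-cancelˡ p q = trans (swap p q (1/ p)) (trans (cong (q *_) (ℚₚ.*-inverseʳ p)) (ℚₚ.*-identityʳ q))
    where
    swap : ∀ p q r → p * (q * r) ≡ q * (p * r)
    swap p q r = solve (p ∷ q ∷ r ∷ []) ℚ-ring

  *÷-cancelˡ : ∀ p .{{_ : NonZero p}} q → (p * q) ÷ p ≡ q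
  *÷-cancelˡ p q = trans (swap p q (1/ p)) (÷-cancelˡ p q)
    where
    swap : ∀ p q r → p * q * r ≡ p * (q * r)
    swap p q r = solve (p ∷ q ∷ r ∷ []) ℚ-ring

  0≤÷ : ∀ {q} n → 0ℚ ≤ q → 0ℚ ≤ q ÷ fromℕ (suc n)
  0≤÷ n 0≤q = 0≤* 0≤q (*≤* (ℤ.+≤+ ℕ.z≤n))

  ⊔-preserves : ∀ (P : ℚ → Set) {x y} → P x → P y → P (x ⊔ y)
  ⊔-preserves P {x} {y} px py = [ (λ e → subst P (sym e) px) , (λ e → subst P (sym e) py) ]′ (ℚₚ.⊔-sel x y)

  -- Eliminating T = O(1,2,3) from the linear constraints an ROS imposes on it

  module Bounds (M H₁ H₂ H₃ H₄ : ℚ) where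
    open Conditions M H₁ H₂ H₃ H₄ using (D; lhs₁)
    open ℚₚ.≤-Reasoning

    ℓ : ℚ → ℚ → ℚ → ℚ
    ℓ Pab Pac Ha = Pab + Pac - M * (Ha * H₄)

    ℓ₁ ℓ₂ ℓ₃ : ℚ
    ℓ₁ = ℓ (H₁ * H₂) (H₁ * H₃) H₁
    ℓ₂ = ℓ (H₁ * H₂) (H₂ * H₃) H₂
    ℓ₃ = ℓ (H₁ * H₃) (H₂ * H₃) H₃

    -- The masses of the blocks of an ROS with O(1,2,3) = T (see the header) are nonnegative.
    -- T ≤ H₁H₂ and T ≤ H₁H₃ are omitted: they follow from H₃ ≤ H₂ ≤ H₁.
    record Admissible (T : ℚ) : Set where
      field
        0≤T       : 0ℚ ≤ T
        T≤H₂H₃    : T ≤ H₂ * H₃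
        ℓ₁≤2T     : ℓ₁ ≤ 2 * T
        ℓ₂≤2T     : ℓ₂ ≤ 2 * T
        ℓ₃≤2T     : ℓ₃ ≤ 2 * T
        lhs₁+6T≤D : ⟦ lhs₁ ⟧ℚ + 6 * T ≤ ⟦ D ⟧ℚ

    lhs₂≡lhs₁+3ℓ₁ : 3 * (M * H₄ + H₁) * (H₁ + H₂ + H₃ + M * H₄ - M * H₄ - H₁)
                  ≡ 3 * M * H₄ * (H₁ + H₂ + H₃) + 3 * (H₁ * H₂ + H₁ * H₃ - M * (H₁ * H₄))
    lhs₂≡lhs₁+3ℓ₁ = solve (M ∷ H₁ ∷ H₂ ∷ H₃ ∷ H₄ ∷ []) ℚ-ring

    lhs₂≡lhs₁+3ℓ₂ : 3 * (M * H₄ + H₂) * (H₁ + H₂ + H₃ + M * H₄ - M * H₄ - H₂)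
                  ≡ 3 * M * H₄ * (H₁ + H₂ + H₃) + 3 * (H₁ * H₂ + H₂ * H₃ - M * (H₂ * H₄))
    lhs₂≡lhs₁+3ℓ₂ = solve (M ∷ H₁ ∷ H₂ ∷ H₃ ∷ H₄ ∷ []) ℚ-ring

    lhs₂≡lhs₁+3ℓ₃ : 3 * (M * H₄ + H₃) * (H₁ + H₂ + H₃ + M * H₄ - M * H₄ - H₃)
                  ≡ 3 * M * H₄ * (H₁ + H₂ + H₃) + 3 * (H₁ * H₃ + H₂ * H₃ - M * (H₃ * H₄))
    lhs₂≡lhs₁+3ℓ₃ = solve (M ∷ H₁ ∷ H₂ ∷ H₃ ∷ H₄ ∷ []) ℚ-ring

    admissible⇒conditions : 0ℚ < H₂ → ∀ {T} → Admissible T → Conditions M H₁ H₂ H₃ H₄ _≤ℚ-expr_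
    admissible⇒conditions 0<H₂ {T} adm =
        ℚₚ.≤-trans (x≤x+y (0≤* (0≤fromℕ 6) 0≤T)) lhs₁+6T≤D
      , (cond₂ lhs₂≡lhs₁+3ℓ₁ ℓ₁≤2T , cond₂ lhs₂≡lhs₁+3ℓ₂ ℓ₂≤2T , cond₂ lhs₂≡lhs₁+3ℓ₃ ℓ₃≤2T)
      , cond₃ , cond₄
      where
      open Admissible adm

      cond₂ : ∀ {x e} → e ≡ ⟦ lhs₁ ⟧ℚ + 3 * x → x ≤ 2 * T → e ≤ ⟦ D ⟧ℚ
      cond₂ {x} {e} e≡ x≤2T = begin
        e                         ≡⟨ e≡ ⟩
        ⟦ lhs₁ ⟧ℚ + 3 * x         ≤⟨ ℚₚ.+-monoʳ-≤ ⟦ lhs₁ ⟧ℚ (ℚₚ.*-monoˡ-≤-nonNeg 3 x≤2T) ⟩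
        ⟦ lhs₁ ⟧ℚ + 3 * (2 * T)   ≡⟨ cong (⟦ lhs₁ ⟧ℚ +_) (sym (ℚₚ.*-assoc 3 2 T)) ⟩
        ⟦ lhs₁ ⟧ℚ + 6 * T         ≤⟨ lhs₁+6T≤D ⟩
        ⟦ D ⟧ℚ                    ∎

      ≤2H₂H₃ : ∀ {x} → x ≤ 2 * T → x ≤ 2 * (H₂ * H₃)
      ≤2H₂H₃ x≤2T = ℚₚ.≤-trans x≤2T (ℚₚ.*-monoˡ-≤-nonNeg 2 T≤H₂H₃)

      cond₃ : H₁ * (H₂ + H₃) ≤ M * H₁ * H₄ + 2 * H₂ * H₃
      cond₃ = begin
        H₁ * (H₂ + H₃)                                  ≡⟨ solve (M ∷ H₁ ∷ H₂ ∷ H₃ ∷ H₄ ∷ []) ℚ-ring ⟩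
        (H₁ * H₂ + H₁ * H₃ - M * (H₁ * H₄)) + M * H₁ * H₄ ≤⟨ ℚₚ.+-monoˡ-≤ (M * H₁ * H₄) (≤2H₂H₃ ℓ₁≤2T) ⟩
        2 * (H₂ * H₃) + M * H₁ * H₄                     ≡⟨ solve (M ∷ H₁ ∷ H₂ ∷ H₃ ∷ H₄ ∷ []) ℚ-ring ⟩
        M * H₁ * H₄ + 2 * H₂ * H₃                       ∎

      cond₄ : H₁ - H₃ ≤ M * H₄
      cond₄ = ℚₚ.*-cancelˡ-≤-pos H₂ {{positive 0<H₂}} (begin
        H₂ * (H₁ - H₃)
          ≡⟨ solve (M ∷ H₁ ∷ H₂ ∷ H₃ ∷ H₄ ∷ []) ℚ-ring ⟩
        (H₁ * H₂ + H₂ * H₃ - M * (H₂ * H₄)) + (H₂ * (M * H₄) - 2 * (H₂ * H₃))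
          ≤⟨ ℚₚ.+-monoˡ-≤ _ (≤2H₂H₃ ℓ₂≤2T) ⟩
        2 * (H₂ * H₃) + (H₂ * (M * H₄) - 2 * (H₂ * H₃))
          ≡⟨ solve (M ∷ H₁ ∷ H₂ ∷ H₃ ∷ H₄ ∷ []) ℚ-ring ⟩
        H₂ * (M * H₄) ∎)

    -- 2T has the lower bounds 0, ℓ₁, ℓ₂, ℓ₃ and the upper bounds 2H₂H₃ and (D − lhs₁)/3; the
    -- conditions say that each lower bound is below each upper bound, so the largest one works.
    conditions⇒admissible : 0ℚ ≤ H₃ → H₃ ≤ H₂ → Conditions M H₁ H₂ H₃ H₄ _≤ℚ-expr_ →
                            Admissible (½ * (0ℚ ⊔ ℓ₁ ⊔ ℓ₂ ⊔ ℓ₃))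
    conditions⇒admissible 0≤H₃ H₃≤H₂ (cond₁ , (cond₂₁ , cond₂₂ , cond₂₃) , cond₃ , cond₄) = record
      { 0≤T       = ℚₚ.*-monoˡ-≤-nonNeg ½ 0≤τ
      ; T≤H₂H₃    = ℚₚ.≤-trans (ℚₚ.*-monoˡ-≤-nonNeg ½ τ≤2H₂H₃) (ℚₚ.≤-reflexive (½*2* (H₂ * H₃)))
      ; ℓ₁≤2T     = subst (ℓ₁ ≤_) (sym (2*½* τ)) ℓ₁≤τ
      ; ℓ₂≤2T     = subst (ℓ₂ ≤_) (sym (2*½* τ)) ℓ₂≤τ
      ; ℓ₃≤2T     = subst (ℓ₃ ≤_) (sym (2*½* τ)) ℓ₃≤τ
      ; lhs₁+6T≤D = subst (λ y → ⟦ lhs₁ ⟧ℚ + y ≤ ⟦ D ⟧ℚ) (sym (6*½* τ)) lhs₁+3τ≤D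
      }
      where
      τ : ℚ
      τ = 0ℚ ⊔ ℓ₁ ⊔ ℓ₂ ⊔ ℓ₃

      ½*2* : ∀ x → ½ * (2 * x) ≡ x
      ½*2* x = solve (x ∷ []) ℚ-ring
      2*½* : ∀ x → 2 * (½ * x) ≡ x
      2*½* x = solve (x ∷ []) ℚ-ring
      6*½* : ∀ x → 6 * (½ * x) ≡ 3 * x
      6*½* x = solve (x ∷ []) ℚ-ring

      0≤τ : 0ℚ ≤ τ
      0≤τ = ℚₚ.≤-trans (ℚₚ.p≤p⊔q 0ℚ ℓ₁) (ℚₚ.≤-trans (ℚₚ.p≤p⊔q _ ℓ₂) (ℚₚ.p≤p⊔q _ ℓ₃))
      ℓ₁≤τ : ℓ₁ ≤ τ
      ℓ₁≤τ = ℚₚ.≤-trans (ℚₚ.p≤q⊔p 0ℚ ℓ₁) (ℚₚ.≤-trans (ℚₚ.p≤p⊔q _ ℓ₂) (ℚₚ.p≤p⊔q _ ℓ₃))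
      ℓ₂≤τ : ℓ₂ ≤ τ
      ℓ₂≤τ = ℚₚ.≤-trans (ℚₚ.p≤q⊔p (0ℚ ⊔ ℓ₁) ℓ₂) (ℚₚ.p≤p⊔q _ ℓ₃)
      ℓ₃≤τ : ℓ₃ ≤ τ
      ℓ₃≤τ = ℚₚ.p≤q⊔p (0ℚ ⊔ ℓ₁ ⊔ ℓ₂) ℓ₃

      0≤H₂ : 0ℚ ≤ H₂
      0≤H₂ = ℚₚ.≤-trans 0≤H₃ H₃≤H₂

      Upper : ℚ → Set
      Upper x = x ≤ 2 * (H₂ * H₃) × ⟦ lhs₁ ⟧ℚ + 3 * x ≤ ⟦ D ⟧ℚ

      upper-0 : Upper 0ℚ
      upper-0 = 0≤* (0≤fromℕ 2) (0≤* 0≤H₂ 0≤H₃)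
              , subst (_≤ ⟦ D ⟧ℚ) (sym (ℚₚ.+-identityʳ ⟦ lhs₁ ⟧ℚ)) cond₁

      upper-ℓ₁ : Upper ℓ₁
      upper-ℓ₁ = (begin
          H₁ * H₂ + H₁ * H₃ - M * (H₁ * H₄)           ≡⟨ solve (M ∷ H₁ ∷ H₂ ∷ H₃ ∷ H₄ ∷ []) ℚ-ring ⟩
          H₁ * (H₂ + H₃) - M * H₁ * H₄              ≤⟨ ℚₚ.+-monoˡ-≤ (- (M * H₁ * H₄)) cond₃ ⟩
          M * H₁ * H₄ + 2 * H₂ * H₃ - M * H₁ * H₄   ≡⟨ solve (M ∷ H₁ ∷ H₂ ∷ H₃ ∷ H₄ ∷ []) ℚ-ring ⟩
          2 * (H₂ * H₃)                             ∎)
        , subst (_≤ ⟦ D ⟧ℚ) lhs₂≡lhs₁+3ℓ₁ cond₂₁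

      upper-ℓ₂ : Upper ℓ₂
      upper-ℓ₂ = (begin
          H₁ * H₂ + H₂ * H₃ - M * (H₂ * H₄)              ≡⟨ solve (M ∷ H₁ ∷ H₂ ∷ H₃ ∷ H₄ ∷ []) ℚ-ring ⟩
          2 * (H₂ * H₃) - H₂ * (M * H₄ - (H₁ - H₃))    ≤⟨ x-y≤x (0≤* 0≤H₂ (0≤y-x cond₄)) ⟩
          2 * (H₂ * H₃)                                ∎)
        , subst (_≤ ⟦ D ⟧ℚ) lhs₂≡lhs₁+3ℓ₂ cond₂₂

      upper-ℓ₃ : Upper ℓ₃
      upper-ℓ₃ = (begin
          H₁ * H₃ + H₂ * H₃ - M * (H₃ * H₄)
            ≡⟨ solve (M ∷ H₁ ∷ H₂ ∷ H₃ ∷ H₄ ∷ []) ℚ-ring ⟩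
          2 * (H₂ * H₃) - (H₃ * (M * H₄ - (H₁ - H₃)) + H₃ * (H₂ - H₃))
            ≤⟨ x-y≤x (ℚₚ.+-mono-≤ (0≤* 0≤H₃ (0≤y-x cond₄)) (0≤* 0≤H₃ (0≤y-x H₃≤H₂))) ⟩
          2 * (H₂ * H₃) ∎)
        , subst (_≤ ⟦ D ⟧ℚ) lhs₂≡lhs₁+3ℓ₃ cond₂₃

      upper-τ : Upper τ
      upper-τ = ⊔-preserves Upper (⊔-preserves Upper (⊔-preserves Upper upper-0 upper-ℓ₁) upper-ℓ₂) upper-ℓ₃

      τ≤2H₂H₃ : τ ≤ 2 * (H₂ * H₃)
      τ≤2H₂H₃ = proj₁ upper-τ

      lhs₁+3τ≤D : ⟦ lhs₁ ⟧ℚ + 3 * τ ≤ ⟦ D ⟧ℚ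
      lhs₁+3τ≤D = proj₂ upper-τ

    line-so-total : ∀ T Pab Pac Ha → (Pab - T) + ((Pac - T) + (2 * T - (Pab + Pac - M * (Ha * H₄)))) ≡ M * (Ha * H₄)
    line-so-total T Pab Pac Ha = solve (M ∷ H₄ ∷ T ∷ Pab ∷ Pac ∷ Ha ∷ []) ℚ-ring

    line-oo-total : ∀ T →
        (2 * T - (H₁ * H₂ + H₁ * H₃ - M * (H₁ * H₄)))
      + ((2 * T - (H₁ * H₂ + H₂ * H₃ - M * (H₂ * H₄)))
      + ((2 * T - (H₁ * H₃ + H₂ * H₃ - M * (H₃ * H₄)))
      + ((H₁ + H₂ + H₃ + M * H₄) * (H₁ + H₂ + H₃ + M * H₄) - (H₁ * H₁ + H₂ * H₂ + H₃ * H₃ + M * (H₄ * H₄))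
         - (3 * M * H₄ * (H₁ + H₂ + H₃) + 6 * T))))
      ≡ M * ((M - 1ℚ) * (H₄ * H₄))
    line-oo-total T = solve (M ∷ H₁ ∷ H₂ ∷ H₃ ∷ H₄ ∷ T ∷ []) ℚ-ring

    block-sums⇒admissible : ∀ {T A₁₂ A₁₃ A₂₃ B₁ B₂ B₃ C} →
      T + A₁₂ ≡ H₁ * H₂ → T + A₁₃ ≡ H₁ * H₃ → T + A₂₃ ≡ H₂ * H₃ →
      A₁₂ + (A₁₃ + B₁) ≡ M * (H₁ * H₄) → A₁₂ + (A₂₃ + B₂) ≡ M * (H₂ * H₄) → A₁₃ + (A₂₃ + B₃) ≡ M * (H₃ * H₄) →
      B₁ + (B₂ + (B₃ + C)) ≡ M * (M * (H₄ * H₄)) →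
      0ℚ ≤ T → 0ℚ ≤ A₂₃ → 0ℚ ≤ B₁ → 0ℚ ≤ B₂ → 0ℚ ≤ B₃ → M * (H₄ * H₄) ≤ C →
      Admissible T
    block-sums⇒admissible {T} {A₁₂} {A₁₃} {A₂₃} {B₁} {B₂} {B₃} {C}
      line₁₂ line₁₃ line₂₃ ∑line₁ₓ ∑line₂ₓ ∑line₃ₓ ∑lineₓᵧ 0≤T 0≤A₂₃ 0≤B₁ 0≤B₂ 0≤B₃ MH₄²≤C = record
      { 0≤T       = 0≤T
      ; T≤H₂H₃    = subst (T ≤_) line₂₃ (x≤x+y 0≤A₂₃)
      ; ℓ₁≤2T     = 0≤y-x⇒x≤y (subst (0ℚ ≤_) B₁≡2T-ℓ₁ 0≤B₁)
      ; ℓ₂≤2T     = 0≤y-x⇒x≤y (subst (0ℚ ≤_) B₂≡2T-ℓ₂ 0≤B₂)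
      ; ℓ₃≤2T     = 0≤y-x⇒x≤y (subst (0ℚ ≤_) B₃≡2T-ℓ₃ 0≤B₃)
      ; lhs₁+6T≤D = 0≤y-x⇒x≤y (subst (0ℚ ≤_) C-MH₄²≡D-lhs₁-6T (0≤y-x MH₄²≤C))
      }
      where
      B≡2T-ℓ : ∀ {A A′ B Pab Pac} Ha → T + A ≡ Pab → T + A′ ≡ Pac → A + (A′ + B) ≡ M * (Ha * H₄) →
               B ≡ 2 * T - ℓ Pab Pac Ha
      B≡2T-ℓ {A} {A′} {B} {Pab} {Pac} Ha e e′ e″ = begin-equality
        B                                                 ≡⟨ solve (T ∷ A ∷ A′ ∷ B ∷ []) ℚ-ring ⟩
        2 * T - ((T + A) + (T + A′) - (A + (A′ + B)))     ≡⟨ cong₃ (λ u v w → 2 * T - (u + v - w)) e e′ e″ ⟩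
        2 * T - ℓ Pab Pac Ha                              ∎

      B₁≡2T-ℓ₁ : B₁ ≡ 2 * T - ℓ₁
      B₁≡2T-ℓ₁ = B≡2T-ℓ H₁ line₁₂ line₁₃ ∑line₁ₓ
      B₂≡2T-ℓ₂ : B₂ ≡ 2 * T - ℓ₂
      B₂≡2T-ℓ₂ = B≡2T-ℓ H₂ line₁₂ line₂₃ ∑line₂ₓ
      B₃≡2T-ℓ₃ : B₃ ≡ 2 * T - ℓ₃
      B₃≡2T-ℓ₃ = B≡2T-ℓ H₃ line₁₃ line₂₃ ∑line₃ₓ

      C-MH₄²≡D-lhs₁-6T : C - M * (H₄ * H₄) ≡ ⟦ D ⟧ℚ - (⟦ lhs₁ ⟧ℚ + 6 * T)
      C-MH₄²≡D-lhs₁-6T = begin-equality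
        C - M * (H₄ * H₄)
          ≡⟨ solve (M ∷ H₄ ∷ B₁ ∷ B₂ ∷ B₃ ∷ C ∷ []) ℚ-ring ⟩
        (B₁ + (B₂ + (B₃ + C))) - M * (H₄ * H₄) - (B₁ + (B₂ + B₃))
          ≡⟨ cong₂ (λ u v → u - M * (H₄ * H₄) - v) ∑lineₓᵧ (cong₃ (λ u v w → u + (v + w)) B₁≡2T-ℓ₁ B₂≡2T-ℓ₂ B₃≡2T-ℓ₃) ⟩
        M * (M * (H₄ * H₄)) - M * (H₄ * H₄) - ((2 * T - ℓ₁) + ((2 * T - ℓ₂) + (2 * T - ℓ₃)))
          ≡⟨ MMK-MK _ ⟩
        M * ((M - 1ℚ) * (H₄ * H₄)) - ((2 * T - ℓ₁) + ((2 * T - ℓ₂) + (2 * T - ℓ₃)))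
          ≡⟨ cong (_- ((2 * T - ℓ₁) + ((2 * T - ℓ₂) + (2 * T - ℓ₃)))) (sym (line-oo-total T)) ⟩
        ((2 * T - ℓ₁) + ((2 * T - ℓ₂) + ((2 * T - ℓ₃) + (⟦ D ⟧ℚ - (⟦ lhs₁ ⟧ℚ + 6 * T)))))
          - ((2 * T - ℓ₁) + ((2 * T - ℓ₂) + (2 * T - ℓ₃)))
          ≡⟨ cancel (2 * T - ℓ₁) (2 * T - ℓ₂) (2 * T - ℓ₃) _ ⟩
        ⟦ D ⟧ℚ - (⟦ lhs₁ ⟧ℚ + 6 * T) ∎
        where
        MMK-MK : ∀ x → M * (M * (H₄ * H₄)) - M * (H₄ * H₄) - x ≡ M * ((M - 1ℚ) * (H₄ * H₄)) - x
        MMK-MK x = solve (M ∷ H₄ ∷ x ∷ []) ℚ-ring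
        cancel : ∀ a b c x → a + (b + (c + x)) - (a + (b + c)) ≡ x
        cancel a b c x = solve (a ∷ b ∷ c ∷ x ∷ []) ℚ-ring

  open import Algebra.Properties.CommutativeMonoid.Sum ℚₚ.+-0-commutativeMonoid using (sum; ∑-distrib-+; sum-cong-≗; sum-replicate-zero)

  sumℚ≡sum : ∀ {n} (f : Fin n → ℚ) → sumℚ f ≡ sum f
  sumℚ≡sum {ℕ.zero}  f = refl
  sumℚ≡sum {suc n} f = cong (f zero +_) (sumℚ≡sum (λ i → f (suc i)))

  fromℕ-suc : ∀ n → fromℕ (suc n) ≡ 1ℚ + fromℕ n
  fromℕ-suc n = trans (cong fromℤ (ℤₚ.pos-+ 1 n)) (fromℤ-homo-+ (ℤ.+ 1) (ℤ.+ n))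

  c+n*c : ∀ n c → c + fromℕ n * c ≡ fromℕ (suc n) * c
  c+n*c n c = trans (c+x*c c (fromℕ n)) (cong (_* c) (sym (fromℕ-suc n)))
    where
    c+x*c : ∀ c x → c + x * c ≡ (1ℚ + x) * c
    c+x*c c x = solve (c ∷ x ∷ []) ℚ-ring

  sum-const : ∀ n c → sum {n} (λ _ → c) ≡ fromℕ n * c
  sum-const ℕ.zero c = sym (ℚₚ.*-zeroˡ c)
  sum-const (suc n) c = trans (cong (c +_) (sum-const n c)) (c+n*c n c)

  sum-nonneg : ∀ {n} {f : Fin n → ℚ} → (∀ i → 0ℚ ≤ f i) → 0ℚ ≤ sum f
  sum-nonneg {ℕ.zero}  0≤f = ℚₚ.≤-refl
  sum-nonneg {suc n} 0≤f = ℚₚ.+-mono-≤ (0≤f zero) (sum-nonneg (λ i → 0≤f (suc i)))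

  sum-mono-≤ : ∀ {n} {f g : Fin n → ℚ} → (∀ i → f i ≤ g i) → sum f ≤ sum g
  sum-mono-≤ {ℕ.zero}  f≤g = ℚₚ.≤-refl
  sum-mono-≤ {suc n} f≤g = ℚₚ.+-mono-≤ (f≤g zero) (sum-mono-≤ (λ i → f≤g (suc i)))

  ≤-sum : ∀ {n} {f : Fin n → ℚ} → (∀ i → 0ℚ ≤ f i) → ∀ i → f i ≤ sum f
  ≤-sum {suc n} 0≤f zero    = x≤x+y (sum-nonneg (λ i → 0≤f (suc i)))
  ≤-sum {suc n} 0≤f (suc i) = subst (_≤ _) (ℚₚ.+-identityˡ _) (ℚₚ.+-mono-≤ (0≤f zero) (≤-sum (λ i → 0≤f (suc i)) i))

  ∑-distrib-+₃ : ∀ {n} (f g h : Fin n → ℚ) → sum (λ x → f x + (g x + h x)) ≡ sum f + (sum g + sum h)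
  ∑-distrib-+₃ f g h = trans (∑-distrib-+ f _) (cong (sum f +_) (∑-distrib-+ g h))

  ∑-distrib-+₄ : ∀ {n} (f g h k : Fin n → ℚ) →
                 sum (λ x → f x + (g x + (h x + k x))) ≡ sum f + (sum g + (sum h + sum k))
  ∑-distrib-+₄ f g h k = trans (∑-distrib-+ f _) (cong (sum f +_) (∑-distrib-+₃ g h k))

  sum-of-rows₃ : ∀ {n} {f g h : Fin n → ℚ} {c} → (∀ x → f x + (g x + h x) ≡ c) →
                 sum f + (sum g + sum h) ≡ fromℕ n * c
  sum-of-rows₃ {n} {f} {g} {h} {c} rows = trans (sym (∑-distrib-+₃ f g h)) (trans (sum-cong-≗ rows) (sum-const n c))

  sum-of-rows₄ : ∀ {n} {f g h k : Fin n → ℚ} {c} → (∀ x → f x + (g x + (h x + k x)) ≡ c) →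
                 sum f + (sum g + (sum h + sum k)) ≡ fromℕ n * c
  sum-of-rows₄ {n} {f} {g} {h} {k} {c} rows = trans (sym (∑-distrib-+₄ f g h k)) (trans (sum-cong-≗ rows) (sum-const n c))

  _==_ : ∀ {n} → Fin n → Fin n → Bool
  i == j = does (i Finₚ.≟ j)

  ==-refl : ∀ {n} (i : Fin n) → (i == i) ≡ true
  ==-refl i = dec-true (i Finₚ.≟ i) refl

  ≢⇒==-false : ∀ {n} {i j : Fin n} → i ≢ j → (i == j) ≡ false
  ≢⇒==-false {i = i} {j} = dec-false (i Finₚ.≟ j)

  sum-δ : ∀ {n} (i : Fin n) c → sum (λ l → if i == l then c else 0ℚ) ≡ c
  sum-δ {suc n} zero    c = trans (cong (c +_) (sum-replicate-zero n)) (ℚₚ.+-identityʳ c)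
  sum-δ {suc n} (suc i) c = trans (ℚₚ.+-identityˡ _) (sum-δ i c)

  sum-except₁ : ∀ {n} (x : Fin (suc n)) c → sum (λ z → if x == z then 0ℚ else c) ≡ fromℕ n * c
  sum-except₁ zero            c = trans (ℚₚ.+-identityˡ _) (sum-const _ c)
  sum-except₁ {suc n} (suc x) c = trans (cong (c +_) (sum-except₁ x c)) (c+n*c n c)

  sum-except₂ : ∀ {n} {x y : Fin (suc (suc n))} → x ≢ y → ∀ c →
                sum (λ z → if x == z then 0ℚ else if y == z then 0ℚ else c) ≡ fromℕ n * c
  sum-except₂ {x = zero}  {zero}  x≢y c = ⊥-elim (x≢y refl)
  sum-except₂ {x = zero}  {suc y} _   c = trans (ℚₚ.+-identityˡ _) (sum-except₁ y c)
  sum-except₂ {x = suc x} {zero}  _   c = trans (ℚₚ.+-identityˡ _) (sum-except₁ x c)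
  sum-except₂ {ℕ.zero} {suc zero}  {suc zero}  x≢y c = ⊥-elim (x≢y refl)
  sum-except₂ {suc n}  {suc x}     {suc y}     x≢y c =
    trans (cong (c +_) (sum-except₂ (x≢y ∘ cong suc) c)) (c+n*c n c)

  s₁ s₂ s₃ : ∀ {m} → Fin (3 ℕ.+ m)
  s₁ = zero
  s₂ = suc zero
  s₃ = suc (suc zero)

  ord : ∀ {m} → Fin m → Fin (3 ℕ.+ m)
  ord x = suc (suc (suc x))

  ord-injective : ∀ {m} {x y : Fin m} → ord x ≡ ord y → x ≡ y
  ord-injective refl = refl

  +-cong₃ : ∀ {a a′ b b′ c c′ r} → a ≡ a′ → b ≡ b′ → c ≡ c′ → a + (b + (c + r)) ≡ a′ + (b′ + (c′ + r))
  +-cong₃ refl refl refl = refl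

  -- Block sums of an ROS

  module Necessity {m h₁ h₂ h₃ h₄ : ℕ} (R : ROS (seqP m h₁ h₂ h₃ h₄)) where
    open ROS R
    open Conditions (fromℕ m) (fromℕ h₁) (fromℕ h₂) (fromℕ h₃) (fromℕ h₄) using (D; lhs₁)
    open Bounds (fromℕ m) (fromℕ h₁) (fromℕ h₂) (fromℕ h₃) (fromℕ h₄)
    open ℚₚ.≤-Reasoning

    M H₁ H₂ H₃ H₄ : ℚ
    M  = fromℕ m
    H₁ = fromℕ h₁
    H₂ = fromℕ h₂
    H₃ = fromℕ h₃
    H₄ = fromℕ h₄

    p : Fin (3 ℕ.+ m) → ℕ
    p = seqP m h₁ h₂ h₃ h₄

    p-ord : ∀ x → p (ord x) ≡ h₄
    p-ord x = lookup-replicate x h₄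

    line : ∀ i j → sum (O i j) ≡ fromℕ (p i) * fromℕ (p j)
    line i j = trans (sym (sumℚ≡sum (O i j))) (trans (lineSum i j) (ℕtoℚ-* (p i) (p j)))

    line-ord : ∀ i x → sum (O i (ord x)) ≡ fromℕ (p i) * H₄
    line-ord i x = trans (line i (ord x)) (cong (λ h → fromℕ (p i) * fromℕ h) (p-ord x))

    O-rotate : ∀ i j l → O i j l ≡ O j l i
    O-rotate i j l = trans (symm₁₂ i j l) (symm₂₃ j i l)

    O-iji : ∀ i j → i ≢ j → O i j i ≡ 0ℚ
    O-iji i j i≢j = trans (symm₂₃ i j i) (offDiag i j i≢j)

    O-ijj : ∀ i j → i ≢ j → O i j j ≡ 0ℚ
    O-ijj i j i≢j = trans (O-rotate i j j) (offDiag j i (i≢j ∘ sym))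

    T A₁₂ A₁₃ A₂₃ B₁ B₂ B₃ C : ℚ
    T   = O s₁ s₂ s₃
    A₁₂ = sum (λ x → O s₁ s₂ (ord x))
    A₁₃ = sum (λ x → O s₁ s₃ (ord x))
    A₂₃ = sum (λ x → O s₂ s₃ (ord x))
    B₁  = sum (λ x → sum (λ y → O s₁ (ord x) (ord y)))
    B₂  = sum (λ x → sum (λ y → O s₂ (ord x) (ord y)))
    B₃  = sum (λ x → sum (λ y → O s₃ (ord x) (ord y)))
    C   = sum (λ x → sum (λ y → sum (λ z → O (ord x) (ord y) (ord z))))

    line₁₂ : T + A₁₂ ≡ H₁ * H₂
    line₁₂ = trans (sym (trans (ℚₚ.+-identityˡ _) (ℚₚ.+-identityˡ _)))
      (trans (+-cong₃ {r = A₁₂} (sym (O-iji s₁ s₂ λ ())) (sym (O-ijj s₁ s₂ λ ())) (refl {x = T})) (line s₁ s₂))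

    line₁₃ : T + A₁₃ ≡ H₁ * H₃
    line₁₃ = trans (sym (trans (ℚₚ.+-identityˡ _) (cong (T +_) (ℚₚ.+-identityˡ A₁₃))))
      (trans (+-cong₃ {r = A₁₃} (sym (O-iji s₁ s₃ λ ())) (symm₂₃ s₁ s₂ s₃) (sym (O-ijj s₁ s₃ λ ()))) (line s₁ s₃))

    line₂₃ : T + A₂₃ ≡ H₂ * H₃
    line₂₃ = trans (cong (T +_) (sym (trans (ℚₚ.+-identityˡ _) (ℚₚ.+-identityˡ A₂₃))))
      (trans (+-cong₃ {r = A₂₃} (O-rotate s₁ s₂ s₃) (sym (O-iji s₂ s₃ λ ())) (sym (O-ijj s₂ s₃ λ ()))) (line s₂ s₃))

    ∑line₁ₓ : A₁₂ + (A₁₃ + B₁) ≡ M * (H₁ * H₄)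
    ∑line₁ₓ = sum-of-rows₃ λ x → trans (sym (ℚₚ.+-identityˡ _))
      (trans (+-cong₃ (sym (O-iji s₁ (ord x) λ ())) (symm₂₃ s₁ s₂ (ord x)) (symm₂₃ s₁ s₃ (ord x))) (line-ord s₁ x))

    ∑line₂ₓ : A₁₂ + (A₂₃ + B₂) ≡ M * (H₂ * H₄)
    ∑line₂ₓ = sum-of-rows₃ λ x → trans (cong (O s₁ s₂ (ord x) +_) (sym (ℚₚ.+-identityˡ _)))
      (trans (+-cong₃ (O-rotate s₁ s₂ (ord x)) (sym (O-iji s₂ (ord x) λ ())) (symm₂₃ s₂ s₃ (ord x))) (line-ord s₂ x))

    ∑line₃ₓ : A₁₃ + (A₂₃ + B₃) ≡ M * (H₃ * H₄)
    ∑line₃ₓ = sum-of-rows₃ λ x → trans (cong (λ r → O s₁ s₃ (ord x) + (O s₂ s₃ (ord x) + r)) (sym (ℚₚ.+-identityˡ _)))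
      (trans (+-cong₃ (O-rotate s₁ s₃ (ord x)) (O-rotate s₂ s₃ (ord x)) (sym (O-iji s₃ (ord x) λ ()))) (line-ord s₃ x))

    ∑lineₓᵧ : B₁ + (B₂ + (B₃ + C)) ≡ M * (M * (H₄ * H₄))
    ∑lineₓᵧ = sum-of-rows₄ λ x → sum-of-rows₄ λ y →
      trans (+-cong₃ (O-rotate s₁ (ord x) (ord y)) (O-rotate s₂ (ord x) (ord y)) (O-rotate s₃ (ord x) (ord y)))
            (trans (line-ord (ord x) y) (cong (λ h → fromℕ h * H₄) (p-ord x)))

    O-diag-ord : ∀ x → O (ord x) (ord x) (ord x) ≡ H₄ * H₄
    O-diag-ord x = trans (diagonal (ord x)) (trans (cong (λ h → ℕtoℚ (h ℕ.^ 2)) (p-ord x)) (ℕtoℚ-^2 h₄))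

    MH₄²≤C : M * (H₄ * H₄) ≤ C
    MH₄²≤C = begin
      M * (H₄ * H₄)                          ≡⟨ sym (sum-const m (H₄ * H₄)) ⟩
      sum {m} (λ _ → H₄ * H₄)                ≡⟨ sum-cong-≗ (λ x → sym (O-diag-ord x)) ⟩
      sum (λ x → O (ord x) (ord x) (ord x))  ≤⟨ sum-mono-≤ (λ x → ℚₚ.≤-trans (≤-sum (λ z → nonneg (ord x) (ord x) (ord z)) x)
                                                                       (≤-sum (λ y → sum-nonneg (λ z → nonneg (ord x) (ord y) (ord z))) x)) ⟩
      C                                      ∎

    0≤B : ∀ a → 0ℚ ≤ sum (λ x → sum (λ y → O a (ord x) (ord y)))
    0≤B a = sum-nonneg (λ x → sum-nonneg (λ y → nonneg a (ord x) (ord y)))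

    admissible : Admissible T
    admissible = block-sums⇒admissible line₁₂ line₁₃ line₂₃ ∑line₁ₓ ∑line₂ₓ ∑line₃ₓ ∑lineₓᵧ
      (nonneg s₁ s₂ s₃) (sum-nonneg (λ x → nonneg s₂ s₃ (ord x))) (0≤B s₁) (0≤B s₂) (0≤B s₃) MH₄²≤C

  if-nonneg : ∀ b {x y} → 0ℚ ≤ x → 0ℚ ≤ y → 0ℚ ≤ (if b then x else y)
  if-nonneg true  0≤x 0≤y = 0≤x
  if-nonneg false 0≤x 0≤y = 0≤y

  module SymmetricArray {n} (p : Fin n → ℕ) (w : Fin n → Fin n → Fin n → ℚ)
    (w-sym₁₂ : ∀ i j l → w i j l ≡ w j i l) (w-sym₂₃ : ∀ i j l → w i j l ≡ w i l j) where

    O : Fin n → Fin n → Fin n → ℚ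
    O i j l = if i == j then (if i == l then fromℕ (p i) * fromℕ (p i) else 0ℚ)
              else (if i == l then 0ℚ else if j == l then 0ℚ else w i j l)

    O-off : ∀ {i j} l → i ≢ j → O i j l ≡ (if i == l then 0ℚ else if j == l then 0ℚ else w i j l)
    O-off {i} {j} l i≢j = cong (λ b → if b then (if i == l then fromℕ (p i) * fromℕ (p i) else 0ℚ)
                                      else (if i == l then 0ℚ else if j == l then 0ℚ else w i j l))
                               (≢⇒==-false i≢j)

    O-diag : ∀ i → O i i i ≡ fromℕ (p i) * fromℕ (p i)
    O-diag i = cong (λ b → if b then (if b then fromℕ (p i) * fromℕ (p i) else 0ℚ)
                           else (if b then 0ℚ else if b then 0ℚ else w i i i))
                    (==-refl i)

    O-iil : ∀ {i l} → i ≢ l → O i i l ≡ 0ℚ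
    O-iil {i} {l} i≢l = cong₂ (λ b c → if b then (if c then fromℕ (p i) * fromℕ (p i) else 0ℚ)
                                     else (if c then 0ℚ else if c then 0ℚ else w i i l))
                              (==-refl i) (≢⇒==-false i≢l)

    O-iji : ∀ {i j} → i ≢ j → O i j i ≡ 0ℚ
    O-iji {i} {j} i≢j = trans (O-off i i≢j) (cong (λ b → if b then 0ℚ else if j == i then 0ℚ else w i j i) (==-refl i))

    O-ijj : ∀ {i j} → i ≢ j → O i j j ≡ 0ℚ
    O-ijj {i} {j} i≢j = trans (O-off j i≢j)
      (cong₂ (λ b c → if b then 0ℚ else if c then 0ℚ else w i j j) (≢⇒==-false i≢j) (==-refl j))

    O-distinct : ∀ {i j l} → i ≢ j → i ≢ l → j ≢ l → O i j l ≡ w i j l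
    O-distinct {i} {j} {l} i≢j i≢l j≢l = trans (O-off l i≢j)
      (cong₂ (λ b c → if b then 0ℚ else if c then 0ℚ else w i j l) (≢⇒==-false i≢l) (≢⇒==-false j≢l))

    O-sym₁₂ : ∀ i j l → O i j l ≡ O j i l
    O-sym₁₂ i j l = cases (i Finₚ.≟ j) (i Finₚ.≟ l) (j Finₚ.≟ l)
      where
      cases : Dec (i ≡ j) → Dec (i ≡ l) → Dec (j ≡ l) → O i j l ≡ O j i l
      cases (yes refl) _          _          = refl
      cases (no i≢j)   (yes refl) _          = trans (O-iji i≢j) (sym (O-ijj (i≢j ∘ sym)))
      cases (no i≢j)   (no _)     (yes refl) = trans (O-ijj i≢j) (sym (O-iji (i≢j ∘ sym)))
      cases (no i≢j)   (no i≢l)   (no j≢l)   =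
        trans (O-distinct i≢j i≢l j≢l) (trans (w-sym₁₂ i j l) (sym (O-distinct (i≢j ∘ sym) j≢l i≢l)))

    O-sym₂₃ : ∀ i j l → O i j l ≡ O i l j
    O-sym₂₃ i j l = cases (j Finₚ.≟ l) (i Finₚ.≟ j) (i Finₚ.≟ l)
      where
      cases : Dec (j ≡ l) → Dec (i ≡ j) → Dec (i ≡ l) → O i j l ≡ O i l j
      cases (yes refl) _          _          = refl
      cases (no j≢l)   (yes refl) _          = trans (O-iil j≢l) (sym (O-iji j≢l))
      cases (no j≢l)   (no i≢j)   (yes refl) = trans (O-iji i≢j) (sym (O-iil i≢j))
      cases (no j≢l)   (no i≢j)   (no i≢l)   =
        trans (O-distinct i≢j i≢l j≢l) (trans (w-sym₂₃ i j l) (sym (O-distinct i≢l i≢j (j≢l ∘ sym))))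

    O-nonneg : (∀ i j l → 0ℚ ≤ w i j l) → ∀ i j l → 0ℚ ≤ O i j l
    O-nonneg 0≤w i j l =
      if-nonneg (i == j) (if-nonneg (i == l) (0≤* (0≤fromℕ (p i)) (0≤fromℕ (p i))) ℚₚ.≤-refl)
                         (if-nonneg (i == l) ℚₚ.≤-refl (if-nonneg (j == l) ℚₚ.≤-refl (0≤w i j l)))

    line-diag : ∀ i → sum (O i i) ≡ fromℕ (p i) * fromℕ (p i)
    line-diag i = trans (sum-cong-≗ (λ l → cong (λ b → if b then (if i == l then fromℕ (p i) * fromℕ (p i) else 0ℚ)
                                                      else (if i == l then 0ℚ else if i == l then 0ℚ else w i i l))
                                                 (==-refl i)))
                        (sum-δ i (fromℕ (p i) * fromℕ (p i)))

    line-flip : ∀ i j → sum (O i j) ≡ fromℕ (p i) * fromℕ (p j) → sum (O j i) ≡ fromℕ (p j) * fromℕ (p i)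
    line-flip i j line = trans (sum-cong-≗ (O-sym₁₂ j i)) (trans line (ℚₚ.*-comm (fromℕ (p i)) (fromℕ (p j))))

    toROS : (∀ i j l → 0ℚ ≤ w i j l) → (∀ i j → i ≢ j → sum (O i j) ≡ fromℕ (p i) * fromℕ (p j)) → ROS p
    toROS 0≤w line-off = record
      { O        = O
      ; symm₁₂   = O-sym₁₂
      ; symm₂₃   = O-sym₂₃
      ; nonneg   = O-nonneg 0≤w
      ; lineSum  = λ i j → trans (sumℚ≡sum (O i j)) (trans (line i j) (sym (ℕtoℚ-* (p i) (p j))))
      ; diagonal = λ i → trans (O-diag i) (sym (ℕtoℚ-^2 (p i)))
      ; offDiag  = λ i j → O-iil
      }
      where
      line : ∀ i j → sum (O i j) ≡ fromℕ (p i) * fromℕ (p j)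
      line i j = cases (i Finₚ.≟ j)
        where
        cases : Dec (i ≡ j) → sum (O i j) ≡ fromℕ (p i) * fromℕ (p j)
        cases (yes refl) = line-diag i
        cases (no i≢j)   = line-off i j i≢j

  -- The ROS built from an admissible value of O(1,2,3)

  module Construction (m′ h₁ h₂ h₃ h₄ : ℕ) (h₃≤h₂ : h₃ ℕ.≤ h₂) (h₂≤h₁ : h₂ ℕ.≤ h₁) {T : ℚ}
    (adm : Bounds.Admissible (fromℕ (3 ℕ.+ m′)) (fromℕ h₁) (fromℕ h₂) (fromℕ h₃) (fromℕ h₄) T) where

    m : ℕ
    m = 3 ℕ.+ m′

    M M₁ M₂ H₁ H₂ H₃ H₄ : ℚ
    M  = fromℕ m
    M₁ = fromℕ (2 ℕ.+ m′)
    M₂ = fromℕ (1 ℕ.+ m′)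
    H₁ = fromℕ h₁
    H₂ = fromℕ h₂
    H₃ = fromℕ h₃
    H₄ = fromℕ h₄

    open Conditions M H₁ H₂ H₃ H₄ using (D; lhs₁)
    open Bounds M H₁ H₂ H₃ H₄
    open Admissible adm
    open ℚₚ.≤-Reasoning

    p : Fin (3 ℕ.+ m) → ℕ
    p = seqP m h₁ h₂ h₃ h₄

    p-ord : ∀ x → p (ord x) ≡ h₄
    p-ord x = lookup-replicate x h₄

    -- On distinct triples O depends only on which special indices occur; each block's mass is
    -- spread evenly over its m, m(m − 1) or m(m − 1)(m − 2) cells.
    weight₂ : ℚ → ℚ
    weight₂ P = (P - T) ÷ M

    weight₁ : ℚ → ℚ
    weight₁ ℓₐ = (2 * T - ℓₐ) ÷ M ÷ M₁

    weight₀ : ℚ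
    weight₀ = (⟦ D ⟧ℚ - (⟦ lhs₁ ⟧ℚ + 6 * T)) ÷ M ÷ M₁ ÷ M₂

    weight : Bool → Bool → Bool → ℚ
    weight true  true  true  = T
    weight true  true  false = weight₂ (H₁ * H₂)
    weight true  false true  = weight₂ (H₁ * H₃)
    weight false true  true  = weight₂ (H₂ * H₃)
    weight true  false false = weight₁ ℓ₁
    weight false true  false = weight₁ ℓ₂
    weight false false true  = weight₁ ℓ₃
    weight false false false = weight₀

    0≤H₃ : 0ℚ ≤ H₃
    0≤H₃ = 0≤fromℕ h₃

    T≤H₁H₃ : T ≤ H₁ * H₃
    T≤H₁H₃ = ℚₚ.≤-trans T≤H₂H₃ (ℚₚ.*-monoʳ-≤-nonNeg H₃ {{nonNegative 0≤H₃}} (fromℤ-mono-≤ (ℤ.+≤+ h₂≤h₁)))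

    T≤H₁H₂ : T ≤ H₁ * H₂
    T≤H₁H₂ = ℚₚ.≤-trans T≤H₁H₃ (ℚₚ.*-monoˡ-≤-nonNeg H₁ {{nonNegative (0≤fromℕ h₁)}} (fromℤ-mono-≤ (ℤ.+≤+ h₃≤h₂)))

    0≤weight : ∀ a b c → 0ℚ ≤ weight a b c
    0≤weight true  true  true  = 0≤T
    0≤weight true  true  false = 0≤÷ (2 ℕ.+ m′) (0≤y-x T≤H₁H₂)
    0≤weight true  false true  = 0≤÷ (2 ℕ.+ m′) (0≤y-x T≤H₁H₃)
    0≤weight false true  true  = 0≤÷ (2 ℕ.+ m′) (0≤y-x T≤H₂H₃)
    0≤weight true  false false = 0≤÷ (1 ℕ.+ m′) (0≤÷ (2 ℕ.+ m′) (0≤y-x ℓ₁≤2T))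
    0≤weight false true  false = 0≤÷ (1 ℕ.+ m′) (0≤÷ (2 ℕ.+ m′) (0≤y-x ℓ₂≤2T))
    0≤weight false false true  = 0≤÷ (1 ℕ.+ m′) (0≤÷ (2 ℕ.+ m′) (0≤y-x ℓ₃≤2T))
    0≤weight false false false = 0≤÷ m′ (0≤÷ (1 ℕ.+ m′) (0≤÷ (2 ℕ.+ m′) (0≤y-x lhs₁+6T≤D)))

    meets : Fin (3 ℕ.+ m) → Fin (3 ℕ.+ m) → Fin (3 ℕ.+ m) → Fin (3 ℕ.+ m) → Bool
    meets a i j l = a == i ∨ (a == j ∨ a == l)

    w : Fin (3 ℕ.+ m) → Fin (3 ℕ.+ m) → Fin (3 ℕ.+ m) → ℚ
    w i j l = weight (meets s₁ i j l) (meets s₂ i j l) (meets s₃ i j l)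

    meets-sym₁₂ : ∀ a i j l → meets a i j l ≡ meets a j i l
    meets-sym₁₂ a i j l = trans (sym (∨-assoc (a == i) (a == j) (a == l)))
      (trans (cong (_∨ (a == l)) (∨-comm (a == i) (a == j))) (∨-assoc (a == j) (a == i) (a == l)))

    meets-sym₂₃ : ∀ a i j l → meets a i j l ≡ meets a i l j
    meets-sym₂₃ a i j l = cong ((a == i) ∨_) (∨-comm (a == j) (a == l))

    open SymmetricArray p w
      (λ i j l → cong₃ weight (meets-sym₁₂ s₁ i j l) (meets-sym₁₂ s₂ i j l) (meets-sym₁₂ s₃ i j l))
      (λ i j l → cong₃ weight (meets-sym₂₃ s₁ i j l) (meets-sym₂₃ s₂ i j l) (meets-sym₂₃ s₃ i j l))

    tail₂ : ℚ → ℚ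
    tail₂ P = sum {m} (λ _ → weight₂ P)

    tail₁ : Fin m → ℚ → ℚ
    tail₁ x ℓₐ = sum (λ z → if x == z then 0ℚ else weight₁ ℓₐ)

    line-ss : ∀ P → T + tail₂ P ≡ P
    line-ss P = begin-equality
      T + tail₂ P                 ≡⟨ cong (T +_) (sum-const m (weight₂ P)) ⟩
      T + M * ((P - T) ÷ M)       ≡⟨ cong (T +_) (÷-cancelˡ M (P - T)) ⟩
      T + (P - T)                 ≡⟨ x+[y-x] T P ⟩
      P                           ∎
      where
      x+[y-x] : ∀ x y → x + (y - x) ≡ y
      x+[y-x] x y = solve (x ∷ y ∷ []) ℚ-ring

    line-so : ∀ x Pab Pac Ha → weight₂ Pab + (weight₂ Pac + tail₁ x (ℓ Pab Pac Ha)) ≡ Ha * H₄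
    line-so x Pab Pac Ha = begin-equality
      weight₂ Pab + (weight₂ Pac + tail₁ x (ℓ Pab Pac Ha))
        ≡⟨ cong (λ s → weight₂ Pab + (weight₂ Pac + s)) (trans (sum-except₁ x _) (÷-cancelˡ M₁ _)) ⟩
      (Pab - T) ÷ M + ((Pac - T) ÷ M + (2 * T - ℓ Pab Pac Ha) ÷ M)
        ≡⟨ ÷-distrib₃ (Pab - T) (Pac - T) (2 * T - ℓ Pab Pac Ha) (1/ M) ⟩
      ((Pab - T) + ((Pac - T) + (2 * T - ℓ Pab Pac Ha))) ÷ M
        ≡⟨ cong (_÷ M) (line-so-total T Pab Pac Ha) ⟩
      (M * (Ha * H₄)) ÷ M
        ≡⟨ *÷-cancelˡ M (Ha * H₄) ⟩
      Ha * H₄ ∎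
      where
      ÷-distrib₃ : ∀ a b c r → a * r + (b * r + c * r) ≡ (a + (b + c)) * r
      ÷-distrib₃ a b c r = solve (a ∷ b ∷ c ∷ r ∷ []) ℚ-ring

    line-oo : ∀ {x y} → x ≢ y →
      weight₁ ℓ₁ + (weight₁ ℓ₂ + (weight₁ ℓ₃ + sum (λ z → if x == z then 0ℚ else if y == z then 0ℚ else weight₀))) ≡ H₄ * H₄
    line-oo {x} {y} x≢y = begin-equality
      weight₁ ℓ₁ + (weight₁ ℓ₂ + (weight₁ ℓ₃ + sum (λ z → if x == z then 0ℚ else if y == z then 0ℚ else weight₀)))
        ≡⟨ cong (λ s → weight₁ ℓ₁ + (weight₁ ℓ₂ + (weight₁ ℓ₃ + s))) (trans (sum-except₂ x≢y weight₀) (÷-cancelˡ M₂ _)) ⟩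
      weight₁ ℓ₁ + (weight₁ ℓ₂ + (weight₁ ℓ₃ + slack ÷ M ÷ M₁))
        ≡⟨ ÷÷-distrib₄ (2 * T - ℓ₁) (2 * T - ℓ₂) (2 * T - ℓ₃) slack (1/ M) (1/ M₁) ⟩
      ((2 * T - ℓ₁) + ((2 * T - ℓ₂) + ((2 * T - ℓ₃) + slack))) ÷ M ÷ M₁
        ≡⟨ cong (λ u → u ÷ M ÷ M₁) (line-oo-total T) ⟩
      (M * ((M - 1ℚ) * (H₄ * H₄))) ÷ M ÷ M₁
        ≡⟨ cong (λ u → (M * (u * (H₄ * H₄))) ÷ M ÷ M₁) M-1≡M₁ ⟩
      (M * (M₁ * (H₄ * H₄))) ÷ M ÷ M₁
        ≡⟨ cong (_÷ M₁) (*÷-cancelˡ M (M₁ * (H₄ * H₄))) ⟩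
      (M₁ * (H₄ * H₄)) ÷ M₁
        ≡⟨ *÷-cancelˡ M₁ (H₄ * H₄) ⟩
      H₄ * H₄ ∎
      where
      slack : ℚ
      slack = ⟦ D ⟧ℚ - (⟦ lhs₁ ⟧ℚ + 6 * T)
      ÷÷-distrib₄ : ∀ a b c d r s → a * r * s + (b * r * s + (c * r * s + d * r * s)) ≡ (a + (b + (c + d))) * r * s
      ÷÷-distrib₄ a b c d r s = solve (a ∷ b ∷ c ∷ d ∷ r ∷ s ∷ []) ℚ-ring
      1+x-1 : ∀ x → 1ℚ + x - 1ℚ ≡ x
      1+x-1 x = solve (x ∷ []) ℚ-ring
      M-1≡M₁ : M - 1ℚ ≡ M₁
      M-1≡M₁ = trans (cong (_- 1ℚ) (fromℕ-suc (2 ℕ.+ m′))) (1+x-1 M₁)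

    line₁₂ : sum (O s₁ s₂) ≡ H₁ * H₂
    line₁₂ = trans (ℚₚ.+-identityˡ (0ℚ + (T + tail₂ (H₁ * H₂))))
                   (trans (ℚₚ.+-identityˡ (T + tail₂ (H₁ * H₂))) (line-ss (H₁ * H₂)))

    line₁₃ : sum (O s₁ s₃) ≡ H₁ * H₃
    line₁₃ = trans (ℚₚ.+-identityˡ (T + (0ℚ + tail₂ (H₁ * H₃))))
                   (trans (cong (T +_) (ℚₚ.+-identityˡ (tail₂ (H₁ * H₃)))) (line-ss (H₁ * H₃)))

    line₂₃ : sum (O s₂ s₃) ≡ H₂ * H₃
    line₂₃ = trans (cong (T +_) (trans (ℚₚ.+-identityˡ (0ℚ + tail₂ (H₂ * H₃))) (ℚₚ.+-identityˡ (tail₂ (H₂ * H₃)))))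
                   (line-ss (H₂ * H₃))

    line-ord : ∀ i x → sum (O i (ord x)) ≡ fromℕ (p i) * H₄ → sum (O i (ord x)) ≡ fromℕ (p i) * fromℕ (p (ord x))
    line-ord i x line = trans line (cong (λ h → fromℕ (p i) * fromℕ h) (sym (p-ord x)))

    line₁ₓ : ∀ x → sum (O s₁ (ord x)) ≡ H₁ * fromℕ (p (ord x))
    line₁ₓ x = line-ord s₁ x (trans (ℚₚ.+-identityˡ (weight₂ (H₁ * H₂) + (weight₂ (H₁ * H₃) + tail₁ x ℓ₁)))
                                    (line-so x (H₁ * H₂) (H₁ * H₃) H₁))

    line₂ₓ : ∀ x → sum (O s₂ (ord x)) ≡ H₂ * fromℕ (p (ord x))
    line₂ₓ x = line-ord s₂ x (trans (cong (weight₂ (H₁ * H₂) +_) (ℚₚ.+-identityˡ (weight₂ (H₂ * H₃) + tail₁ x ℓ₂)))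
                                    (line-so x (H₁ * H₂) (H₂ * H₃) H₂))

    line₃ₓ : ∀ x → sum (O s₃ (ord x)) ≡ H₃ * fromℕ (p (ord x))
    line₃ₓ x = line-ord s₃ x (trans (cong (λ r → weight₂ (H₁ * H₃) + (weight₂ (H₂ * H₃) + r)) (ℚₚ.+-identityˡ (tail₁ x ℓ₃)))
                                    (line-so x (H₁ * H₃) (H₂ * H₃) H₃))

    lineₓᵧ : ∀ {x y} → x ≢ y → sum (O (ord x) (ord y)) ≡ fromℕ (p (ord x)) * fromℕ (p (ord y))
    lineₓᵧ {x} {y} x≢y = begin-equality
      sum (O (ord x) (ord y))
        ≡⟨ sum-cong-≗ (λ l → O-off l (x≢y ∘ ord-injective)) ⟩
      weight₁ ℓ₁ + (weight₁ ℓ₂ + (weight₁ ℓ₃ + sum (λ z → if x == z then 0ℚ else if y == z then 0ℚ else weight₀)))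
        ≡⟨ line-oo x≢y ⟩
      H₄ * H₄
        ≡⟨ cong₂ (λ h h′ → fromℕ h * fromℕ h′) (sym (p-ord x)) (sym (p-ord y)) ⟩
      fromℕ (p (ord x)) * fromℕ (p (ord y)) ∎

    line-off : ∀ i j → i ≢ j → sum (O i j) ≡ fromℕ (p i) * fromℕ (p j)
    line-off zero                zero                i≢j = ⊥-elim (i≢j refl)
    line-off zero                (suc zero)          _   = line₁₂
    line-off zero                (suc (suc zero))    _   = line₁₃
    line-off zero                (suc (suc (suc x))) _   = line₁ₓ x
    line-off (suc zero)          zero                _   = line-flip s₁ s₂ line₁₂
    line-off (suc zero)          (suc zero)          i≢j = ⊥-elim (i≢j refl)
    line-off (suc zero)          (suc (suc zero))    _   = line₂₃
    line-off (suc zero)          (suc (suc (suc x))) _   = line₂ₓ x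
    line-off (suc (suc zero))    zero                _   = line-flip s₁ s₃ line₁₃
    line-off (suc (suc zero))    (suc zero)          _   = line-flip s₂ s₃ line₂₃
    line-off (suc (suc zero))    (suc (suc zero))    i≢j = ⊥-elim (i≢j refl)
    line-off (suc (suc zero))    (suc (suc (suc x))) _   = line₃ₓ x
    line-off (suc (suc (suc x))) zero                _   = line-flip s₁ (ord x) (line₁ₓ x)
    line-off (suc (suc (suc x))) (suc zero)          _   = line-flip s₂ (ord x) (line₂ₓ x)
    line-off (suc (suc (suc x))) (suc (suc zero))    _   = line-flip s₃ (ord x) (line₃ₓ x)
    line-off (suc (suc (suc x))) (suc (suc (suc y))) i≢j = lineₓᵧ (i≢j ∘ cong ord)

    ros : ROS p
    ros = toROS (λ i j l → 0≤weight (meets s₁ i j l) (meets s₂ i j l) (meets s₃ i j l)) line-off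

open import Data.Nat using (_≤_; s≤s; z≤n)
open import Data.Integer using (ℤ; +_; _+_; _-_; _*_) renaming (_≤_ to _≤ℤ_)

mainTheorem6 : (m h₁ h₂ h₃ h₄ : ℕ) → 3 ≤ m → 1 ≤ h₁ → 1 ≤ h₂ → 1 ≤ h₃ → 1 ≤ h₄ → h₂ ≤ h₁ → h₃ ≤ h₂ →
    let M = + m
        H₁ = + h₁
        H₂ = + h₂
        H₃ = + h₃
        H₄ = + h₄
        N = H₁ + H₂ + H₃ + M * H₄
        S = H₁ * H₁ + H₂ * H₂ + H₃ * H₃ + M * (H₄ * H₄)
        D = N * N - S
        cond2 = λ (Hj : ℤ) → (+ 3) * (M * H₄ + Hj) * (N - M * H₄ - Hj) ≤ℤ D
    in ROS (seqP m h₁ h₂ h₃ h₄)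
       ⇔ (((+ 3) * M * H₄ * (H₁ + H₂ + H₃) ≤ℤ D)
         × (cond2 H₁ × cond2 H₂ × cond2 H₃)
         × (H₁ * (H₂ + H₃) ≤ℤ M * H₁ * H₄ + (+ 2) * H₂ * H₃)
         × (H₁ - H₃ ≤ℤ M * H₄))
mainTheorem6 (suc (suc (suc m′))) h₁ (suc h₂′) h₃ h₄ (s≤s (s≤s (s≤s z≤n))) _ _ _ _ h₂≤h₁ h₃≤h₂ =
  mk⇔ (λ R → from (admissible⇒conditions (ℚₚ.positive⁻¹ (fromℕ (suc h₂′))) (Necessity.admissible R)))
      (λ c → Construction.ros m′ h₁ (suc h₂′) h₃ h₄ h₃≤h₂ h₂≤h₁
               (conditions⇒admissible (0≤fromℕ h₃) (fromℤ-mono-≤ (ℤ.+≤+ h₃≤h₂)) (to c)))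
  where
  open Bounds (fromℕ (3 ℕ.+ m′)) (fromℕ h₁) (fromℕ (suc h₂′)) (fromℕ h₃) (fromℕ h₄)
  open Equivalence (Conditions-fromℤ (+ (3 ℕ.+ m′)) (+ h₁) (+ suc h₂′) (+ h₃) (+ h₄))
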